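{- Let $V\subset A^n$ be a neighborly $d$-code in standard form, with $C^1_0=\{2,\ldots,s\}$, and let $M\ge 2$ be an integer such that $|V|=2^d-M$ and $|V^{1,0}|>9M$. Then for every inflation $V^\delta$ of $V$ on the set $J=C^1_0=\{2,\ldots,s\}$ we have $$V^{\delta}=\{0*\cdots *\}\cup V^{1,1}.$$ Moreover, if $V^{1,*}\neq\emptyset$, then $\operatorname{vol}(V^\delta)>\operatorname{vol}(V)$ for every inflation $V^\delta$ of $V$ on $J$, and consequently $|V^{1,*}|<M$ and $|V^{1,0}|>2^{d-1}-M$, $|V^{1,1}|>2^{d-1}-M$.
   Context: Words and codes. Let $A=\{0,1,*\}$, and for a positive integer $n$ let $A^n$ be the set of all words $v=v_1\ldots v_n$ with $v_i\in A$ for $i\in[n]=\{1,\ldots,n\}$. For $v\in A^n$ put $\operatorname{prop}(v)=\{i\in[n]\colon v_i\neq *\}$. Two words $v,u\in A^n$ are dichotomous at the $i$-th position if $v_i,u_i\in\{0,1\}$ and $v_i+u_i=1$; they are dichotomous if this holds for some $i\in[n]$, and neighborly if there is precisely one such $i$. A set $V\subset A^n$ is a code if every two distinct words in $V$ are dichotomous, and a neighborly code if every two distinct words in $V$ are neighborly. For $d\ge1$, a code $V$ is a $d$-code if $|\operatorname{prop}(v)|=d$ for every $v\in V$; a neighborly $d$-code is a $d$-code which is a neighborly code. For $v\in A^n$ put $|v|=2^{n-|\operatorname{prop}(v)|}$, and for a code $V\subset A^n$ put $\operatorname{vol}(V)=\sum_{v\in V}|v|$; $|V|$ denotes the cardinality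 of the set $V$. For $j\in[n]$ and $a\in A$ let $V^{j,a}=\{v\in V\colon v_j=a\}$. The word $0*\cdots *\in A^n$ has first letter $0$ and all other letters $*$. Standard form. For a neighborly code $V\subset A^n$ and $\varepsilon\in\{0,1\}$ let $C^1_\varepsilon$ be the set of all $k\in[n]\setminus\{1\}$ for which there are $v,u\in V^{1,\varepsilon}$ with $v_k,u_k\in\{0,1\}$ and $v_k+u_k=1$. The code $V$ is in standard form if: (i) $|V^{1,0}|=\max_{i\in[n],\,\varepsilon\in\{0,1\}}|V^{i,\varepsilon}|$; (ii) $|V^{1,0}|\ge 2$ and $|V^{1,1}|\ge 2$ (for a neighborly code this implies that $C^1_0$ and $C^1_1$ are non-empty and disjoint); (iii) $C^1_0=\{2,\ldots,s\}$ and $C^1_1=\{s+1,\ldots,r\}$ for some $s,r\in[n]$, so that $D=[n]\setminus(\{1\}\cup C^1_0\cup C^1_1)$ is either empty or equal to $\{r+1,\ldots,n\}$; (iv) if $D\neq\emptyset$, then $v_k\in\{0,*\}$ for every $k\in D$ and every $v\in V^{1,0}\cup V^{1,1}$. Inflation. Let $V\subset A^n$ be a code and $i\in[n]$. For $\eta\in\{0,1\}$ let $V^{i,\eta,*}=\{v_1\ldots v_{i-1}*v_{i+1}\ldots v_n\colon v\in V^{i,\eta}\}$. An inflation of $V$ at the $i$-th position is the code $V^{\delta_i}=V^{i,\delta_i,*}\cup V^{i,*}$, where $\delta_i\in\{0,1\}$ is such that $\operatorname{vol}(V^{i,\delta_i'})\le\operatorname{vol}(V^{i,\delta_i})$ with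 $\delta_i'=1-\delta_i$ (if the two volumes are equal, either choice of $\delta_i$ is allowed). For a set $J\subset[n]$ with $m$ elements, an inflation of $V$ on the set $J$ is any code of the form $V^\delta=(\ldots(V^{\delta_{j_1}})^{\delta_{j_2}}\ldots)^{\delta_{j_m}}$, where $(j_1,\ldots,j_m)$ is some ordering of the elements of $J$ and, at each step $k$, writing $W$ for the code obtained at the previous step (with $W=V$ when $k=1$), the parameter $\delta_{j_k}\in\{0,1\}$ satisfies $\operatorname{vol}(W^{j_k,1-\delta_{j_k}})\le\operatorname{vol}(W^{j_k,\delta_{j_k}})$ and the code produced at step $k$ is the inflation $W^{\delta_{j_k}}=W^{j_k,\delta_{j_k},*}\cup W^{j_k,*}$ of $W$ at the $j_k$-th position; here $\delta=(\delta_{j_k})_{k\in[m]}$. -}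

module Defs where

open import Level using (0ℓ)
open import Data.Bool.Base using (Bool; false; true; not)
import Data.Bool.Properties as Bool
open import Data.Fin.Base using (Fin; zero; suc; _<_; _≤_)
open import Data.Fin.Subset using (Subset; ∣_∣)
open import Data.List.Base using (List; []; _∷_; _++_; length; map; filter; sum; deduplicate)
open import Data.List.Membership.Propositional using (_∈_)
open import Data.List.Relation.Unary.Unique.Propositional using (Unique)
open import Data.Maybe.Base using (Maybe; just; nothing; is-just)
import Data.Maybe.Properties as Maybe
import Data.Nat.Base as ℕ
open ℕ using (ℕ)
open import Data.Product using (∃; ∃₂; ∃!; _×_)
open import Data.Sum.Base using (_⊎_)
import Data.Vec.Base as Vec
open Vec using (Vec; lookup; replicate; _[_]≔_)
import Data.Vec.Properties as Vec
open import Function.Bundles using (_⇔_)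
open import Relation.Binary.Definitions using (DecidableEquality)
open import Relation.Binary.PropositionalEquality using (_≡_; _≢_)
open import Relation.Nullary.Negation using (¬_)
open import Relation.Unary using (Pred; _≐_)

private
  variable
    n : ℕ

-- The digits 0 and 1 are the Booleans false and true, so 1 - ε is not ε.

Letter : Set
Letter = Maybe Bool

pattern 𝟘 = just false
pattern 𝟙 = just true
pattern ⋆ = nothing

_≟ᴸ_ : DecidableEquality Letter
_≟ᴸ_ = Maybe.≡-dec Bool._≟_

-- Position i of [n] is the element i - 1 of Fin n; in particular position 1
-- is zero.

Word : ℕ → Set
Word n = Vec Letter n

_≟ᵂ_ : DecidableEquality (Word n)
_≟ᵂ_ = Vec.≡-dec _≟ᴸ_

prop : Word n → Subset n
prop = Vec.map is-just

DichotomousAt : Word n → Word n → Fin n → Set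
DichotomousAt v u i = ∃ λ ε → lookup v i ≡ just ε × lookup u i ≡ just (not ε)

Dichotomous : Word n → Word n → Set
Dichotomous v u = ∃ (DichotomousAt v u)

Neighborly : Word n → Word n → Set
Neighborly v u = ∃! _≡_ (DichotomousAt v u)

-- A finite set of words is a list considered up to order and repetition:
-- equality of sets is _∼[ set ]_, union is _++_, and card and vol take each
-- distinct word once.

WordSet : ℕ → Set
WordSet n = List (Word n)

card : WordSet n → ℕ
card V = length (deduplicate _≟ᵂ_ V)

size : Word n → ℕ
size {n} v = 2 ℕ.^ (n ℕ.∸ ∣ prop v ∣)

vol : WordSet n → ℕ
vol V = sum (map size (deduplicate _≟ᵂ_ V))

IsCode : WordSet n → Set
IsCode V = ∀ {v u} → v ∈ V → u ∈ V → v ≢ u → Dichotomous v u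

IsNeighborlyCode : WordSet n → Set
IsNeighborlyCode V = ∀ {v u} → v ∈ V → u ∈ V → v ≢ u → Neighborly v u

IsDCode : ℕ → WordSet n → Set
IsDCode d V = IsCode V × (∀ {v} → v ∈ V → ∣ prop v ∣ ≡ d)

IsNeighborlyDCode : ℕ → WordSet n → Set
IsNeighborlyDCode d V = IsDCode d V × IsNeighborlyCode V

infixl 8 _^⟨_,_⟩ _^⟨_,_,⋆⟩

_^⟨_,_⟩ : WordSet n → Fin n → Letter → WordSet n
V ^⟨ j , a ⟩ = filter (λ v → lookup v j ≟ᴸ a) V

0⋆⋯⋆ : Word (ℕ.suc n)
0⋆⋯⋆ = 𝟘 Vec.∷ replicate _ ⋆

C¹ : WordSet (ℕ.suc n) → Bool → Pred (Fin (ℕ.suc n)) 0ℓ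
C¹ V ε k = k ≢ zero × (∃₂ λ v u →
  v ∈ V ^⟨ zero , just ε ⟩ × u ∈ V ^⟨ zero , just ε ⟩ × DichotomousAt v u k)

D : WordSet (ℕ.suc n) → Pred (Fin (ℕ.suc n)) 0ℓ
D V k = k ≢ zero × ¬ C¹ V false k × ¬ C¹ V true k

-- The positions i + 1, …, j.
⦅_,_⟧ : Fin n → Fin n → Pred (Fin n) 0ℓ
⦅ i , j ⟧ k = i < k × k ≤ j

record IsStandardForm (V : WordSet (ℕ.suc n)) : Set where
  field
    maximal : ∀ i ε → card (V ^⟨ i , just ε ⟩) ℕ.≤ card (V ^⟨ zero , 𝟘 ⟩)
    card₀≥2 : card (V ^⟨ zero , 𝟘 ⟩) ℕ.≥ 2
    card₁≥2 : card (V ^⟨ zero , 𝟙 ⟩) ℕ.≥ 2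
    s r     : Fin (ℕ.suc n)
    C¹₀≐    : C¹ V false ≐ ⦅ zero , s ⟧
    C¹₁≐    : C¹ V true ≐ ⦅ s , r ⟧
    D-0⋆    : ∀ {k v} → D V k → v ∈ V ^⟨ zero , 𝟘 ⟩ ++ V ^⟨ zero , 𝟙 ⟩ →
              lookup v k ≡ 𝟘 ⊎ lookup v k ≡ ⋆

_^⟨_,_,⋆⟩ : WordSet n → Fin n → Bool → WordSet n
V ^⟨ i , η ,⋆⟩ = map (_[ i ]≔ ⋆) (V ^⟨ i , just η ⟩)

inflate : WordSet n → Fin n → Bool → WordSet n
inflate V i δ = V ^⟨ i , δ ,⋆⟩ ++ V ^⟨ i , ⋆ ⟩

data InflationAlong {n} : List (Fin n) → WordSet n → WordSet n → Set where
  done : ∀ {V} → InflationAlong [] V V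
  step : ∀ {j js V W} δ →
         vol (V ^⟨ j , just (not δ) ⟩) ℕ.≤ vol (V ^⟨ j , just δ ⟩) →
         InflationAlong js (inflate V j δ) W →
         InflationAlong (j ∷ js) V W

IsOrderingOf : Pred (Fin n) 0ℓ → List (Fin n) → Set
IsOrderingOf J js = Unique js × (∀ k → k ∈ js ⇔ J k)

IsInflation : WordSet n → Pred (Fin n) 0ℓ → WordSet n → Set
IsInflation V J W = ∃ λ js → IsOrderingOf J js × InflationAlong js V W

{-# OPTIONS --safe #-}
module Submission where

-- Read a word as a subcube of the cube {0,1}^n; a code is then a family of
-- pairwise disjoint subcubes. Words with first letter ⋆ meet both halves of the
-- cube equally, so after cancelling them the words starting with 0 and the words
-- starting with 1 fill corresponding regions of their halves equally well, up to
-- the volume missed by the code ("balance"). Inflation does not decrease volume,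
-- so this applies to V and to its inflation W with the error M words; in
-- particular |V^{1,1}| ≥ |V^{1,0}| - M > 8M. All of V^{1,1} survives in W, and at
-- most one word a starting with 0 does. If a did not exist or had the letter 0 at
-- some k ∈ D, balance for W in the region with 1 at k, and then balance for V there,
-- would show that all but 6M words of V^{1,0} ∪ V^{1,1} have 0 at k, against the
-- maximality of V^{1,0}. So a = 0⋆⋯⋆, and no word of W starts with ⋆.
-- If W had the volume of V, the two choices would tie at every step of every
-- inflation, and steering by a word of V^{1,⋆} would make that word survive.

open import Defs
open import Data.Bool.Base using (Bool; false; true; not)
open import Data.Bool.Properties using (not-involutive)
open import Data.Fin.Base as Fin using (Fin; zero; suc)
import Data.Fin.Properties as Fin
open import Data.Fin.Subset.Properties using (∣p∣≤n)
open import Data.List.Base using (List; []; _∷_; [_]; _++_; length; map; deduplicate; filter; allFin)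
open import Data.List.Membership.Propositional using (_∈_; _∉_)
open import Data.List.Membership.Propositional.Properties
  using (∈-map⁺; ∈-map⁻; ∈-++⁺ˡ; ∈-++⁺ʳ; ∈-++⁻; ∈-∃++; ∈-filter⁺; ∈-filter⁻; ∈-deduplicate⁺; ∈-deduplicate⁻; ∈-allFin)
open import Data.List.Properties using (map-++; map-∘)
open import Data.List.Relation.Binary.BagAndSetEquality using (_∼[_]_; set)
open import Data.List.Relation.Binary.Disjoint.Propositional using (Disjoint)
open import Data.List.Relation.Binary.Permutation.Propositional.Properties using (map⁺; shift)
open import Data.List.Relation.Binary.Permutation.Propositional.Properties.WithK using (dedup-++-↭)
open import Data.List.Relation.Binary.Subset.Propositional using (_⊆_)
open import Data.List.Relation.Unary.All as All using (All; []; _∷_)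
open import Data.List.Relation.Unary.AllPairs using (AllPairs; []; _∷_)
import Data.List.Relation.Unary.AllPairs.Properties as AllPairs
open import Data.List.Relation.Unary.Any using (here; there)
open import Data.List.Relation.Unary.Unique.DecPropositional.Properties using (deduplicate-!)
open import Data.List.Relation.Unary.Unique.Propositional using (Unique)
import Data.List.Relation.Unary.Unique.Propositional.Properties as Unique
open import Data.Maybe.Base using (just)
open import Data.Nat.Base
open import Data.Nat.ListAction using (sum)
open import Data.Nat.ListAction.Properties using (sum-++; sum-↭)
open import Data.Nat.Properties
open import Data.Nat.Tactic.RingSolver using (solve-∀)
open import Data.Product.Base using (_×_; _,_; proj₁; proj₂; ∃)
open import Data.Sum.Base using (_⊎_; inj₁; inj₂)
open import Data.Vec.Base as Vec using ([]; _∷_; lookup; replicate; _[_]≔_)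
open import Data.Vec.Properties
  using (lookup∘update; lookup∘update′; []≔-lookup; lookup-replicate; tabulate∘lookup; tabulate-cong)
open import Function.Base using (_∘_; const; _on_)
open import Function.Bundles using (mk⇔; Equivalence)
open import Relation.Binary.Core using (Rel)
open import Relation.Binary.PropositionalEquality
  using (_≡_; _≢_; refl; sym; trans; cong; cong₂; subst; module ≡-Reasoning)
open import Relation.Nullary using (¬_; Dec; yes; no; contradiction; _×-dec_)
open import Relation.Unary using (_≐_)

private
  variable
    A : Set
    n : ℕ
    V U W : WordSet n

-- Sums over finite sets of words

unique⇒allPairs : ∀ {ℓ} {R : Rel A ℓ} {xs : List A} → Unique xs →
  (∀ {x y} → x ∈ xs → y ∈ xs → x ≢ y → R x y) → AllPairs R xs
unique⇒allPairs [] r = []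
unique⇒allPairs (x≢ ∷ xs!) r =
  All.tabulate (λ y∈ → r (here refl) (there y∈) (All.lookup x≢ y∈)) ∷
  unique⇒allPairs xs! (λ x∈ y∈ → r (there x∈) (there y∈))

-- Induction on `xs`: the head is cancelled against one occurrence in `ys`, and uniqueness keeps the
-- rest of `xs` inside what remains.
sum-⊆ : ∀ (f : A → ℕ) {xs ys} → Unique xs → xs ⊆ ys → sum (map f xs) ≤ sum (map f ys)
sum-⊆ f [] xs⊆ys = z≤n
sum-⊆ f {x ∷ xs} (x≢ ∷ xs!) xs⊆ys with ∈-∃++ (xs⊆ys (here refl))
... | ps , qs , refl = begin
  f x + sum (map f xs)          ≤⟨ +-monoʳ-≤ (f x) (sum-⊆ f xs! rest) ⟩
  sum (map f (x ∷ ps ++ qs))    ≡⟨ sum-↭ (map⁺ f (shift x ps qs)) ⟨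
  sum (map f (ps ++ x ∷ qs))    ∎
  where
  open ≤-Reasoning
  rest : xs ⊆ ps ++ qs
  rest y∈ with ∈-++⁻ ps (xs⊆ys (there y∈))
  ... | inj₁ y∈ps         = ∈-++⁺ˡ y∈ps
  ... | inj₂ (here refl)  = contradiction refl (All.lookup x≢ y∈)
  ... | inj₂ (there y∈qs) = ∈-++⁺ʳ ps y∈qs

sum-mono : ∀ {f g : A → ℕ} xs → (∀ {x} → x ∈ xs → f x ≤ g x) → sum (map f xs) ≤ sum (map g xs)
sum-mono []       f≤g = z≤n
sum-mono (x ∷ xs) f≤g = +-mono-≤ (f≤g (here refl)) (sum-mono xs (f≤g ∘ there))

sum-+ : ∀ (f g : A → ℕ) xs →
  sum (map (λ x → f x + g x) xs) ≡ sum (map f xs) + sum (map g xs)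
sum-+ f g []       = refl
sum-+ f g (x ∷ xs) rewrite sum-+ f g xs = interchange (f x) (g x) (sum (map f xs)) (sum (map g xs))
  where
  interchange : ∀ a b c d → (a + b) + (c + d) ≡ (a + c) + (b + d)
  interchange = solve-∀

-- `vol` is the weight `size` and `card` the constant weight 1, so facts about finite sets are
-- proved once for both.
∑ : (Word n → ℕ) → WordSet n → ℕ
∑ f V = sum (map f (deduplicate _≟ᵂ_ V))

∑-⊆ : ∀ (f : Word n → ℕ) → V ⊆ U → ∑ f V ≤ ∑ f U
∑-⊆ {V = V} f V⊆U = sum-⊆ f (deduplicate-! _≟ᵂ_ V)
  (∈-deduplicate⁺ _≟ᵂ_ ∘ V⊆U ∘ ∈-deduplicate⁻ _≟ᵂ_ V)

∑-set : ∀ (f : Word n → ℕ) → V ⊆ U → U ⊆ V → ∑ f V ≡ ∑ f U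
∑-set f V⊆U U⊆V = ≤-antisym (∑-⊆ f V⊆U) (∑-⊆ f U⊆V)

∑-mono : ∀ {f g : Word n → ℕ} → (∀ {v} → v ∈ V → f v ≤ g v) → ∑ f V ≤ ∑ g V
∑-mono {V = V} f≤g = sum-mono _ (f≤g ∘ ∈-deduplicate⁻ _≟ᵂ_ V)

∑-cong : ∀ {f g : Word n → ℕ} → (∀ {v} → v ∈ V → f v ≡ g v) → ∑ f V ≡ ∑ g V
∑-cong f≡g = ≤-antisym (∑-mono (≤-reflexive ∘ f≡g)) (∑-mono (≤-reflexive ∘ sym ∘ f≡g))

∑-++ : ∀ (f : Word n → ℕ) → Disjoint V U → ∑ f (V ++ U) ≡ ∑ f V + ∑ f U
∑-++ {V = V} {U} f V#U = trans (sum-↭ (map⁺ f (dedup-++-↭ _≟ᵂ_ V#U)))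
  (trans (cong sum (map-++ f (deduplicate _≟ᵂ_ V) (deduplicate _≟ᵂ_ U)))
         (sum-++ (map f (deduplicate _≟ᵂ_ V)) (map f (deduplicate _≟ᵂ_ U))))

-- Injectivity on `V` keeps the image of the deduplicated list free of repetitions, so both lists
-- are unique with the same members.
∑-map : ∀ (f : Word n → ℕ) {g : Word n → Word n} →
  (∀ {v u} → v ∈ V → u ∈ V → v ≢ u → g v ≢ g u) → ∑ f (map g V) ≡ ∑ (f ∘ g) V
∑-map {V = V} f {g} g-inj = trans
  (≤-antisym (sum-⊆ f (deduplicate-! _≟ᵂ_ (map g V)) to) (sum-⊆ f (AllPairs.map⁺ gV!) from))
  (sym (cong sum (map-∘ (deduplicate _≟ᵂ_ V))))
  where
  gV! : AllPairs (_≢_ on g) (deduplicate _≟ᵂ_ V)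
  gV! = unique⇒allPairs (deduplicate-! _≟ᵂ_ V)
    (λ v∈ u∈ → g-inj (∈-deduplicate⁻ _≟ᵂ_ V v∈) (∈-deduplicate⁻ _≟ᵂ_ V u∈))
  to : deduplicate _≟ᵂ_ (map g V) ⊆ map g (deduplicate _≟ᵂ_ V)
  to w∈ with ∈-map⁻ g (∈-deduplicate⁻ _≟ᵂ_ (map g V) w∈)
  ... | v , v∈ , refl = ∈-map⁺ g (∈-deduplicate⁺ _≟ᵂ_ v∈)
  from : map g (deduplicate _≟ᵂ_ V) ⊆ deduplicate _≟ᵂ_ (map g V)
  from w∈ with ∈-map⁻ g w∈
  ... | v , v∈ , refl = ∈-deduplicate⁺ _≟ᵂ_ (∈-map⁺ g (∈-deduplicate⁻ _≟ᵂ_ V v∈))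

∑-const : ∀ {f : Word n → ℕ} {e} → (∀ {v} → v ∈ V → f v ≡ e) → ∑ f V ≡ card V * e
∑-const {V = V} {f} {e} f≡e = go (deduplicate _≟ᵂ_ V) (f≡e ∘ ∈-deduplicate⁻ _≟ᵂ_ V)
  where
  go : ∀ xs → (∀ {v} → v ∈ xs → f v ≡ e) → sum (map f xs) ≡ length xs * e
  go []       h = refl
  go (x ∷ xs) h = cong₂ _+_ (h (here refl)) (go xs (h ∘ there))

card≡∑ : ∀ (V : WordSet n) → card V ≡ ∑ (const 1) V
card≡∑ V = trans (sym (*-identityʳ _)) (sym (∑-const {V = V} {f = const 1} (λ _ → refl)))

-- Splitting a word set by the letter at a position

^-⊆ : ∀ (V : WordSet n) i a → V ^⟨ i , a ⟩ ⊆ V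
^-⊆ V i a v∈ = proj₁ (∈-filter⁻ (λ v → lookup v i ≟ᴸ a) v∈)

^-letter : ∀ (V : WordSet n) i {a v} → v ∈ V ^⟨ i , a ⟩ → lookup v i ≡ a
^-letter V i {a} v∈ = proj₂ (∈-filter⁻ (λ v → lookup v i ≟ᴸ a) {xs = V} v∈)

∈-^ : ∀ {V : WordSet n} {i a v} → v ∈ V → lookup v i ≡ a → v ∈ V ^⟨ i , a ⟩
∈-^ {i = i} {a} = ∈-filter⁺ (λ v → lookup v i ≟ᴸ a)

^-disjoint : ∀ (V U : WordSet n) i {a b} → a ≢ b → Disjoint (V ^⟨ i , a ⟩) (U ^⟨ i , b ⟩)
^-disjoint V U i a≢b (v∈a , v∈b) = a≢b (trans (sym (^-letter V i v∈a)) (^-letter U i v∈b))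

just≢just-not : ∀ δ → just δ ≢ just (not δ)
just≢just-not false ()
just≢just-not true ()

letter-cases : ∀ (c : Letter) δ → c ≡ just δ ⊎ c ≡ just (not δ) ⊎ c ≡ ⋆
letter-cases ⋆ δ     = inj₂ (inj₂ refl)
letter-cases 𝟘 false = inj₁ refl
letter-cases 𝟘 true  = inj₂ (inj₁ refl)
letter-cases 𝟙 false = inj₂ (inj₁ refl)
letter-cases 𝟙 true  = inj₁ refl

∑-split : ∀ (f : Word n → ℕ) (V : WordSet n) i δ →
  ∑ f V ≡ ∑ f (V ^⟨ i , just δ ⟩) + ∑ f (V ^⟨ i , just (not δ) ⟩) + ∑ f (V ^⟨ i , ⋆ ⟩)
∑-split f V i δ = trans (∑-set f to from) (trans
    (∑-++ f disj)
    (cong (_+ ∑ f (V ^⟨ i , ⋆ ⟩)) (∑-++ f (^-disjoint V V i (just≢just-not δ)))))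
  where
  halves = V ^⟨ i , just δ ⟩ ++ V ^⟨ i , just (not δ) ⟩
  disj : Disjoint halves (V ^⟨ i , ⋆ ⟩)
  disj (v∈ , v∈⋆) with ∈-++⁻ (V ^⟨ i , just δ ⟩) v∈
  ... | inj₁ v∈δ = ^-disjoint V V i (λ ()) (v∈δ , v∈⋆)
  ... | inj₂ v∈δ′ = ^-disjoint V V i (λ ()) (v∈δ′ , v∈⋆)
  to : V ⊆ halves ++ V ^⟨ i , ⋆ ⟩
  to {v} v∈ with letter-cases (lookup v i) δ
  ... | inj₁ eq        = ∈-++⁺ˡ (∈-++⁺ˡ (∈-^ v∈ eq))
  ... | inj₂ (inj₁ eq) = ∈-++⁺ˡ (∈-++⁺ʳ (V ^⟨ i , just δ ⟩) (∈-^ v∈ eq))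
  ... | inj₂ (inj₂ eq) = ∈-++⁺ʳ halves (∈-^ v∈ eq)
  from : halves ++ V ^⟨ i , ⋆ ⟩ ⊆ V
  from v∈ with ∈-++⁻ halves v∈
  ... | inj₂ v∈⋆ = ^-⊆ V i ⋆ v∈⋆
  ... | inj₁ v∈′ with ∈-++⁻ (V ^⟨ i , just δ ⟩) v∈′
  ...   | inj₁ v∈δ = ^-⊆ V i _ v∈δ
  ...   | inj₂ v∈δ′ = ^-⊆ V i _ v∈δ′

-- Volumes in subcubes

-- The word v stands for the subcube of {0,1}ⁿ of the points that agree with v
-- off its stars; mass r v counts the common points of the subcubes of r and v.
common : Letter → Letter → ℕ
common ⋆ ⋆ = 2
common ⋆ (just _) = 1
common (just _) ⋆ = 1
common 𝟘 𝟘 = 1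
common 𝟙 𝟙 = 1
common 𝟘 𝟙 = 0
common 𝟙 𝟘 = 0

mass : Word n → Word n → ℕ
mass []      []      = 1
mass (c ∷ r) (d ∷ v) = common c d * mass r v

-- Restriction of a family of subcubes to the half cube with first coordinate `ε`; it drives the
-- inductions on dimension below.
slice : Bool → List (Word (suc n)) → List (Word n)
slice ε [] = []
slice ε     ((⋆ ∷ v) ∷ U) = v ∷ slice ε U
slice false ((𝟘 ∷ v) ∷ U) = v ∷ slice false U
slice false ((𝟙 ∷ v) ∷ U) = slice false U
slice true  ((𝟘 ∷ v) ∷ U) = slice true U
slice true  ((𝟙 ∷ v) ∷ U) = v ∷ slice true U

sum-slice : ∀ ε (r : Word n) U →
  sum (map (mass (just ε ∷ r)) U) ≡ sum (map (mass r) (slice ε U))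
sum-slice ε r [] = refl
sum-slice ε     r ((⋆ ∷ v) ∷ U) = cong₂ _+_ (*-identityˡ _) (sum-slice ε r U)
sum-slice false r ((𝟘 ∷ v) ∷ U) = cong₂ _+_ (*-identityˡ _) (sum-slice false r U)
sum-slice false r ((𝟙 ∷ v) ∷ U) = sum-slice false r U
sum-slice true  r ((𝟘 ∷ v) ∷ U) = sum-slice true r U
sum-slice true  r ((𝟙 ∷ v) ∷ U) = cong₂ _+_ (*-identityˡ _) (sum-slice true r U)

-- Subcubes that both meet the half `ε` are not separated by the first coordinate, so disjointness
-- passes to slices.
dichotomous-tail : ∀ {c d} {v u : Word n} ε → c ≡ just ε ⊎ c ≡ ⋆ → d ≡ just ε ⊎ d ≡ ⋆ →
  Dichotomous (c ∷ v) (d ∷ u) → Dichotomous v u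
dichotomous-tail ε c≡ d≡ (suc i , dich) = i , dich
dichotomous-tail ε (inj₁ refl) (inj₁ refl) (zero , .ε , refl , eq) =
  contradiction eq (just≢just-not ε)
dichotomous-tail ε (inj₁ refl) (inj₂ refl) (zero , _ , _ , ())
dichotomous-tail ε (inj₂ refl) d≡ (zero , _ , () , _)

slice-All : ∀ ε {c} {v : Word n} → c ≡ just ε ⊎ c ≡ ⋆ → ∀ U →
  All (Dichotomous (c ∷ v)) U → All (Dichotomous v) (slice ε U)
slice-All ε c≡ [] [] = []
slice-All ε     c≡ ((⋆ ∷ v) ∷ U) (p ∷ ps) = dichotomous-tail ε c≡ (inj₂ refl) p ∷ slice-All ε c≡ U ps
slice-All false c≡ ((𝟘 ∷ v) ∷ U) (p ∷ ps) = dichotomous-tail false c≡ (inj₁ refl) p ∷ slice-All false c≡ U ps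
slice-All false c≡ ((𝟙 ∷ v) ∷ U) (p ∷ ps) = slice-All false c≡ U ps
slice-All true  c≡ ((𝟘 ∷ v) ∷ U) (p ∷ ps) = slice-All true c≡ U ps
slice-All true  c≡ ((𝟙 ∷ v) ∷ U) (p ∷ ps) = dichotomous-tail true c≡ (inj₁ refl) p ∷ slice-All true c≡ U ps

slice-AllPairs : ∀ ε (U : List (Word (suc n))) →
  AllPairs Dichotomous U → AllPairs Dichotomous (slice ε U)
slice-AllPairs ε [] [] = []
slice-AllPairs ε     ((⋆ ∷ v) ∷ U) (p ∷ ps) = slice-All ε (inj₂ refl) U p ∷ slice-AllPairs ε U ps
slice-AllPairs false ((𝟘 ∷ v) ∷ U) (p ∷ ps) = slice-All false (inj₁ refl) U p ∷ slice-AllPairs false U ps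
slice-AllPairs false ((𝟙 ∷ v) ∷ U) (p ∷ ps) = slice-AllPairs false U ps
slice-AllPairs true  ((𝟘 ∷ v) ∷ U) (p ∷ ps) = slice-AllPairs true U ps
slice-AllPairs true  ((𝟙 ∷ v) ∷ U) (p ∷ ps) = slice-All true (inj₁ refl) U p ∷ slice-AllPairs true U ps

common-⋆ : ∀ c → common ⋆ c ≡ common 𝟘 c + common 𝟙 c
common-⋆ ⋆ = refl
common-⋆ 𝟘 = refl
common-⋆ 𝟙 = refl

sum-mass-⋆ : ∀ (r : Word n) U → sum (map (mass (⋆ ∷ r)) U) ≡
  sum (map (mass r) (slice false U)) + sum (map (mass r) (slice true U))
sum-mass-⋆ r U = begin
  sum (map (mass (⋆ ∷ r)) U)
    ≡⟨ halves U ⟩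
  sum (map (mass (𝟘 ∷ r)) U) + sum (map (mass (𝟙 ∷ r)) U)
    ≡⟨ cong₂ _+_ (sum-slice false r U) (sum-slice true r U) ⟩
  sum (map (mass r) (slice false U)) + sum (map (mass r) (slice true U)) ∎
  where
  open ≡-Reasoning
  rearrange : ∀ p q m a b → (p + q) * m + (a + b) ≡ (p * m + a) + (q * m + b)
  rearrange = solve-∀
  halves : ∀ U → sum (map (mass (⋆ ∷ r)) U) ≡
    sum (map (mass (𝟘 ∷ r)) U) + sum (map (mass (𝟙 ∷ r)) U)
  halves [] = refl
  halves ((c ∷ v) ∷ U) rewrite common-⋆ c | halves U =
    rearrange (common 𝟘 c) (common 𝟙 c) (mass r v) _ _

size-⋆∷ : ∀ (v : Word n) → size (⋆ ∷ v) ≡ 2 * size v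
size-⋆∷ v = cong (2 ^_) (+-∸-assoc 1 (∣p∣≤n (prop v)))

⋆⋯⋆ : Word n
⋆⋯⋆ = replicate _ ⋆

mass-⋆⋯⋆ : ∀ (v : Word n) → mass ⋆⋯⋆ v ≡ size v
mass-⋆⋯⋆ [] = refl
mass-⋆⋯⋆ (⋆ ∷ v) = trans (cong (2 *_) (mass-⋆⋯⋆ v)) (sym (size-⋆∷ v))
mass-⋆⋯⋆ (just ε ∷ v) = trans (*-identityˡ _) (mass-⋆⋯⋆ v)

size-⋆⋯⋆ : ∀ n → size (⋆⋯⋆ {n}) ≡ 2 ^ n
size-⋆⋯⋆ zero = refl
size-⋆⋯⋆ (suc n) = trans (size-⋆∷ (⋆⋯⋆ {n})) (cong (2 *_) (size-⋆⋯⋆ n))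

2*m≡m+m : ∀ x → 2 * x ≡ x + x
2*m≡m+m = solve-∀

-- Disjoint subcubes cannot overfill `r`. A digit of `r` selects one slice, a star adds up both; in
-- dimension 0 there is a single point, and no word is dichotomous to itself.
capacity-list : ∀ (r : Word n) {U} → AllPairs Dichotomous U → sum (map (mass r) U) ≤ size r
capacity-list [] [] = z≤n
capacity-list [] {[] ∷ []} _ = ≤-refl
capacity-list [] {[] ∷ [] ∷ _} (((() , _) ∷ _) ∷ _)
capacity-list (just ε ∷ r) {U} ps = begin
  sum (map (mass (just ε ∷ r)) U) ≡⟨ sum-slice ε r U ⟩
  sum (map (mass r) (slice ε U))  ≤⟨ capacity-list r (slice-AllPairs ε U ps) ⟩
  size r                          ∎
  where open ≤-Reasoning
capacity-list (⋆ ∷ r) {U} ps = begin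
  sum (map (mass (⋆ ∷ r)) U)
    ≡⟨ sum-mass-⋆ r U ⟩
  sum (map (mass r) (slice false U)) + sum (map (mass r) (slice true U))
    ≤⟨ +-mono-≤ (capacity-list r (slice-AllPairs false U ps)) (capacity-list r (slice-AllPairs true U ps)) ⟩
  size r + size r
    ≡⟨ 2*m≡m+m (size r) ⟨
  2 * size r
    ≡⟨ size-⋆∷ r ⟨
  size (⋆ ∷ r) ∎
  where open ≤-Reasoning

-- The part of r missed by U is at most the part of the whole cube missed by U;
-- the inequality is arranged so that no subtraction occurs.
deficit-list : ∀ (r : Word n) {U} → AllPairs Dichotomous U →
  size r + sum (map (mass ⋆⋯⋆) U) ≤ 2 ^ n + sum (map (mass r) U)
deficit-list [] _ = ≤-refl
deficit-list {suc n} (⋆ ∷ r) {U} ps = begin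
  size (⋆ ∷ r) + sum (map (mass ⋆⋯⋆) U)
    ≡⟨ cong₂ _+_ (trans (size-⋆∷ r) (2*m≡m+m (size r))) (sum-mass-⋆ ⋆⋯⋆ U) ⟩
  (size r + size r) + (all₀ + all₁)
    ≡⟨ rearrange (size r) all₀ all₁ ⟩
  (size r + all₀) + (size r + all₁)
    ≤⟨ +-mono-≤ (deficit-list r (slice-AllPairs false U ps)) (deficit-list r (slice-AllPairs true U ps)) ⟩
  (2 ^ n + in₀) + (2 ^ n + in₁)
    ≡⟨ rearrange′ (2 ^ n) in₀ in₁ ⟩
  2 ^ suc n + (in₀ + in₁)
    ≡⟨ cong (2 ^ suc n +_) (sum-mass-⋆ r U) ⟨
  2 ^ suc n + sum (map (mass (⋆ ∷ r)) U) ∎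
  where
  open ≤-Reasoning
  all₀ = sum (map (mass ⋆⋯⋆) (slice false U))
  all₁ = sum (map (mass ⋆⋯⋆) (slice true U))
  in₀ = sum (map (mass r) (slice false U))
  in₁ = sum (map (mass r) (slice true U))
  rearrange : ∀ s a b → (s + s) + (a + b) ≡ (s + a) + (s + b)
  rearrange = solve-∀
  rearrange′ : ∀ s a b → (s + a) + (s + b) ≡ 2 * s + (a + b)
  rearrange′ = solve-∀
deficit-list {suc n} (just ε ∷ r) {U} ps = begin
  size r + sum (map (mass ⋆⋯⋆) U)
    ≡⟨ cong (size r +_) (trans (sum-mass-⋆ ⋆⋯⋆ U) (reorder ε)) ⟩
  size r + (sum (map (mass ⋆⋯⋆) (slice ε U)) + sum (map (mass ⋆⋯⋆) (slice (not ε) U)))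
    ≡⟨ +-assoc (size r) _ _ ⟨
  size r + sum (map (mass ⋆⋯⋆) (slice ε U)) + sum (map (mass ⋆⋯⋆) (slice (not ε) U))
    -- Only the slice `ε` meets `r`; the other half contributes at most its whole size `2 ^ n`.
    ≤⟨ +-mono-≤ (deficit-list r (slice-AllPairs ε U ps)) (capacity-list ⋆⋯⋆ (slice-AllPairs (not ε) U ps)) ⟩
  2 ^ n + sum (map (mass r) (slice ε U)) + size (⋆⋯⋆ {n})
    ≡⟨ cong₂ (λ a b → 2 ^ n + a + b) (sym (sum-slice ε r U)) (size-⋆⋯⋆ n) ⟩
  2 ^ n + sum (map (mass (just ε ∷ r)) U) + 2 ^ n
    ≡⟨ rearrange (2 ^ n) _ ⟩
  2 ^ suc n + sum (map (mass (just ε ∷ r)) U) ∎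
  where
  open ≤-Reasoning
  all = λ δ → sum (map (mass ⋆⋯⋆) (slice δ U))
  reorder : ∀ ε → all false + all true ≡ all ε + all (not ε)
  reorder false = refl
  reorder true  = +-comm (all false) (all true)
  rearrange : ∀ s a → s + a + s ≡ 2 * s + a
  rearrange = solve-∀

-- Capacity, deficit and balance of a code

code-AllPairs : IsCode V → AllPairs Dichotomous (deduplicate _≟ᵂ_ V)
code-AllPairs {V = V} code = unique⇒allPairs (deduplicate-! _≟ᵂ_ V)
  (λ v∈ u∈ → code (∈-deduplicate⁻ _≟ᵂ_ V v∈) (∈-deduplicate⁻ _≟ᵂ_ V u∈))

capacity : IsCode V → ∀ r → ∑ (mass r) V ≤ size r
capacity code r = capacity-list r (code-AllPairs code)

deficit : ∀ {V : WordSet n} → IsCode V → ∀ r → size r + vol V ≤ 2 ^ n + ∑ (mass r) V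
deficit {n} {V} code r =
  subst (λ m → size r + m ≤ 2 ^ n + ∑ (mass r) V) (∑-cong {V = V} (λ {v} _ → mass-⋆⋯⋆ v)) (deficit-list r (code-AllPairs code))

mass-dichotomous : ∀ (r v : Word n) → Dichotomous r v → mass r v ≡ 0
mass-dichotomous (𝟘 ∷ r) (_ ∷ v) (zero , _ , refl , refl) = refl
mass-dichotomous (𝟙 ∷ r) (_ ∷ v) (zero , _ , refl , refl) = refl
mass-dichotomous (⋆ ∷ r) (_ ∷ v) (zero , _ , () , _)
mass-dichotomous (c ∷ r) (d ∷ v) (suc i , dich) =
  trans (cong (common c d *_) (mass-dichotomous r v (i , dich))) (*-zeroʳ (common c d))

mass-halves-⋆ : ∀ ε (r : Word n) v → lookup v zero ≡ ⋆ → mass (just ε ∷ r) v ≡ mass (just (not ε) ∷ r) v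
mass-halves-⋆ ε r (_ ∷ _) refl = refl

∑-mass-split : ∀ ε (r : Word n) V → ∑ (mass (just ε ∷ r)) V ≡
  ∑ (mass (just ε ∷ r)) (V ^⟨ zero , just ε ⟩) + ∑ (mass (just ε ∷ r)) (V ^⟨ zero , ⋆ ⟩)
∑-mass-split ε r V = begin
  ∑ f V                        ≡⟨ ∑-split f V zero ε ⟩
  ∑ f Vε + ∑ f Vε′ + ∑ f V⋆    ≡⟨ cong (λ z → ∑ f Vε + z + ∑ f V⋆) (trans (∑-const {V = Vε′} (λ {v} v∈ → mass-dichotomous (just ε ∷ r) v (zero , ε , refl , ^-letter V zero v∈))) (*-zeroʳ (card Vε′))) ⟩
  ∑ f Vε + 0 + ∑ f V⋆          ≡⟨ cong (_+ ∑ f V⋆) (+-identityʳ _) ⟩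
  ∑ f Vε + ∑ f V⋆              ∎
  where
  open ≡-Reasoning
  f = mass (just ε ∷ r)
  Vε = V ^⟨ zero , just ε ⟩
  Vε′ = V ^⟨ zero , just (not ε) ⟩
  V⋆ = V ^⟨ zero , ⋆ ⟩

-- `capacity` bounds the filling of `r` in the half `ε` from above, `deficit` bounds it in the other
-- half from below, and the two regions have equal size. Words starting with `⋆` contribute the same
-- `m` to both and cancel.
balance : ∀ {V : WordSet (suc n)} → IsCode V → ∀ ε r →
  ∑ (mass (just ε ∷ r)) (V ^⟨ zero , just ε ⟩) + vol V ≤
  ∑ (mass (just (not ε) ∷ r)) (V ^⟨ zero , just (not ε) ⟩) + 2 ^ suc n
balance {n} {V} code ε r = +-cancelʳ-≤ m _ _ (begin
  x + vol V + m
    ≡⟨ swap₁ x (vol V) m ⟩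
  (x + m) + vol V
    ≡⟨ cong (_+ vol V) (∑-mass-split ε r V) ⟨
  ∑ (mass (just ε ∷ r)) V + vol V
    ≤⟨ +-monoˡ-≤ (vol V) (capacity code (just ε ∷ r)) ⟩
  size (just (not ε) ∷ r) + vol V
    ≤⟨ deficit code (just (not ε) ∷ r) ⟩
  2 ^ suc n + ∑ (mass (just (not ε) ∷ r)) V
    ≡⟨ cong (2 ^ suc n +_) (∑-mass-split (not ε) r V) ⟩
  2 ^ suc n + (y + ∑ (mass (just (not ε) ∷ r)) (V ^⟨ zero , ⋆ ⟩))
    ≡⟨ cong (λ z → 2 ^ suc n + (y + z)) (∑-cong {V = V ^⟨ zero , ⋆ ⟩} (λ {v} v∈ → mass-halves-⋆ ε r v (^-letter V zero v∈))) ⟨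
  2 ^ suc n + (y + m)
    ≡⟨ swap₂ (2 ^ suc n) y m ⟩
  y + 2 ^ suc n + m ∎)
  where
  open ≤-Reasoning
  x = ∑ (mass (just ε ∷ r)) (V ^⟨ zero , just ε ⟩)
  y = ∑ (mass (just (not ε) ∷ r)) (V ^⟨ zero , just (not ε) ⟩)
  m = ∑ (mass (just ε ∷ r)) (V ^⟨ zero , ⋆ ⟩)
  swap₁ : ∀ x v m → x + v + m ≡ (x + m) + v
  swap₁ = solve-∀
  swap₂ : ∀ t y m → t + (y + m) ≡ y + t + m
  swap₂ = solve-∀

-- Inflations

-- Keeps the two parts of an inflation disjoint: a cleared word that already lay in the code would
-- clash with its preimage.
¬dichotomous-clear : ∀ j (v : Word n) → ¬ Dichotomous v (v [ j ]≔ ⋆)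
¬dichotomous-clear j v (i , ε , vi , ui) with i Fin.≟ j
... | yes refl = contradiction (trans (sym ui) (lookup∘update i v ⋆)) (λ ())
... | no i≢j   = just≢just-not ε (trans (sym vi) (trans (sym (lookup∘update′ i≢j v ⋆)) ui))

dichotomous⇒≢ : ∀ {v u : Word n} → Dichotomous v u → v ≢ u
dichotomous⇒≢ (i , ε , vi , ui) refl = just≢just-not ε (trans (sym vi) ui)

clear-⋆ : ∀ {v : Word n} {j} → lookup v j ≡ ⋆ → v [ j ]≔ ⋆ ≡ v
clear-⋆ {v = v} {j} vj = trans (cong (v [ j ]≔_) (sym vj)) ([]≔-lookup v j)

-- Clearing position `j` does nothing to a star, so both parts of an inflation are images of the
-- same map.
∈-inflate⁻ : ∀ (V : WordSet n) j δ {w} → w ∈ inflate V j δ →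
  ∃ λ v → v ∈ V × lookup v j ≢ just (not δ) × w ≡ v [ j ]≔ ⋆
∈-inflate⁻ V j δ w∈ with ∈-++⁻ (V ^⟨ j , δ ,⋆⟩) w∈
... | inj₂ w∈⋆ = _ , ^-⊆ V j ⋆ w∈⋆ , (λ eq → contradiction (trans (sym wj) eq) (λ ())) , sym (clear-⋆ wj)
  where wj = ^-letter V j w∈⋆
... | inj₁ w∈δ with ∈-map⁻ (_[ j ]≔ ⋆) w∈δ
...   | v , v∈ , refl = v , ^-⊆ V j _ v∈ ,
        (λ eq → just≢just-not δ (trans (sym (^-letter V j v∈)) eq)) , refl

∈-inflate⁺ : ∀ {V : WordSet n} {j} δ {v} → v ∈ V → lookup v j ≢ just (not δ) →
  v [ j ]≔ ⋆ ∈ inflate V j δ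
∈-inflate⁺ {V = V} {j} δ {v} v∈ vj≢ with letter-cases (lookup v j) δ
... | inj₁ vj        = ∈-++⁺ˡ (∈-map⁺ (_[ j ]≔ ⋆) (∈-^ v∈ vj))
... | inj₂ (inj₁ vj) = contradiction vj vj≢
... | inj₂ (inj₂ vj) =
  ∈-++⁺ʳ (V ^⟨ j , δ ,⋆⟩) (subst (_∈ V ^⟨ j , ⋆ ⟩) (sym (clear-⋆ vj)) (∈-^ v∈ vj))

-- With `not δ` excluded from both words, the dichotomy cannot sit at `j`, hence survives the
-- clearing.
dichotomous-clear : ∀ (v u : Word n) {j} δ →
  lookup v j ≢ just (not δ) → lookup u j ≢ just (not δ) →
  Dichotomous v u → Dichotomous (v [ j ]≔ ⋆) (u [ j ]≔ ⋆)
dichotomous-clear v u {j} δ vj≢ uj≢ (i , ε , vi , ui) =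
  i , ε , trans (lookup∘update′ i≢j v ⋆) vi , trans (lookup∘update′ i≢j u ⋆) ui
  where
  opposite : ∀ δ ε → just ε ≢ just (not δ) → ¬ just (not ε) ≢ just (not δ)
  opposite false false _ q = q refl
  opposite false true  p _ = p refl
  opposite true  false p _ = p refl
  opposite true  true  _ q = q refl
  i≢j : i ≢ j
  i≢j refl = opposite δ ε (λ eq → vj≢ (trans vi eq)) (λ eq → uj≢ (trans ui eq))

inflate-code : IsCode V → ∀ j δ → IsCode (inflate V j δ)
inflate-code {V = V} code j δ w∈ w′∈ w≢w′
  with ∈-inflate⁻ V j δ w∈ | ∈-inflate⁻ V j δ w′∈
... | v , v∈ , vj , refl | u , u∈ , uj , refl =
  dichotomous-clear v u δ vj uj (code v∈ u∈ (w≢w′ ∘ cong (_[ j ]≔ ⋆)))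

size-clear : ∀ (v : Word n) j ε → lookup v j ≡ just ε → size (v [ j ]≔ ⋆) ≡ size v + size v
size-clear (just ε ∷ v) zero .ε refl = trans (size-⋆∷ v) (2*m≡m+m (size v))
size-clear (just _ ∷ v) (suc j) ε eq = size-clear v j ε eq
size-clear (⋆ ∷ v) (suc j) ε eq = begin
  size (⋆ ∷ v [ j ]≔ ⋆)         ≡⟨ size-⋆∷ (v [ j ]≔ ⋆) ⟩
  2 * size (v [ j ]≔ ⋆)         ≡⟨ cong (2 *_) (size-clear v j ε eq) ⟩
  2 * (size v + size v)         ≡⟨ *-distribˡ-+ 2 (size v) (size v) ⟩
  2 * size v + 2 * size v       ≡⟨ cong₂ _+_ (size-⋆∷ v) (size-⋆∷ v) ⟨
  size (⋆ ∷ v) + size (⋆ ∷ v)   ∎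
  where open ≡-Reasoning

-- Clearing doubles each size, stays injective because dichotomies survive, and produces no word of
-- `V ^⟨ j , ⋆ ⟩`.
vol-inflate : ∀ {V : WordSet n} → IsCode V → ∀ j δ → vol (inflate V j δ) ≡
  vol (V ^⟨ j , just δ ⟩) + vol (V ^⟨ j , just δ ⟩) + vol (V ^⟨ j , ⋆ ⟩)
vol-inflate {V = V} code j δ = begin
  ∑ size (V ^⟨ j , δ ,⋆⟩ ++ V ^⟨ j , ⋆ ⟩)
    ≡⟨ ∑-++ size disj ⟩
  ∑ size (map (_[ j ]≔ ⋆) Vδ) + ∑ size (V ^⟨ j , ⋆ ⟩)
    ≡⟨ cong (_+ ∑ size (V ^⟨ j , ⋆ ⟩)) (trans (∑-map {V = Vδ} size inj)
         (trans (∑-cong {V = Vδ} (λ {v} v∈ → size-clear v j δ (^-letter V j v∈)))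
                (sum-+ size size (deduplicate _≟ᵂ_ Vδ)))) ⟩
  ∑ size Vδ + ∑ size Vδ + ∑ size (V ^⟨ j , ⋆ ⟩) ∎
  where
  open ≡-Reasoning
  Vδ = V ^⟨ j , just δ ⟩
  ≢not : ∀ {v} → v ∈ Vδ → lookup v j ≢ just (not δ)
  ≢not v∈ eq = just≢just-not δ (trans (sym (^-letter V j v∈)) eq)
  inj : ∀ {v u} → v ∈ Vδ → u ∈ Vδ → v ≢ u → v [ j ]≔ ⋆ ≢ u [ j ]≔ ⋆
  inj {v} {u} v∈ u∈ v≢u = dichotomous⇒≢ (dichotomous-clear v u δ (≢not v∈) (≢not u∈)
    (code (^-⊆ V j _ v∈) (^-⊆ V j _ u∈) v≢u))
  disj : Disjoint (V ^⟨ j , δ ,⋆⟩) (V ^⟨ j , ⋆ ⟩)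
  disj (w∈δ , w∈⋆) with ∈-map⁻ (_[ j ]≔ ⋆) w∈δ
  ... | v , v∈ , refl = ¬dichotomous-clear j v (code (^-⊆ V j _ v∈) (^-⊆ V j ⋆ w∈⋆)
    (λ eq → contradiction
      (trans (sym (^-letter V j v∈)) (trans (cong (λ z → lookup z j) eq) (lookup∘update j v ⋆))) (λ ())))

-- The lighter part is traded for a second copy of the heavier one.
vol-inflate-≤ : ∀ {V : WordSet n} → IsCode V → ∀ j δ →
  vol (V ^⟨ j , just (not δ) ⟩) ≤ vol (V ^⟨ j , just δ ⟩) → vol V ≤ vol (inflate V j δ)
vol-inflate-≤ {V = V} code j δ le = begin
  vol V ≡⟨ ∑-split size V j δ ⟩
  _     ≤⟨ +-monoˡ-≤ (vol (V ^⟨ j , ⋆ ⟩)) (+-monoʳ-≤ (vol (V ^⟨ j , just δ ⟩)) le) ⟩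
  _     ≡⟨ vol-inflate code j δ ⟨
  vol (inflate V j δ) ∎
  where open ≤-Reasoning

vol-inflate-< : ∀ {V : WordSet n} → IsCode V → ∀ j δ →
  vol (V ^⟨ j , just (not δ) ⟩) < vol (V ^⟨ j , just δ ⟩) → vol V < vol (inflate V j δ)
vol-inflate-< {V = V} code j δ lt = begin-strict
  vol V ≡⟨ ∑-split size V j δ ⟩
  _     <⟨ +-monoˡ-< (vol (V ^⟨ j , ⋆ ⟩)) (+-monoʳ-< (vol (V ^⟨ j , just δ ⟩)) lt) ⟩
  _     ≡⟨ vol-inflate code j δ ⟨
  vol (inflate V j δ) ∎
  where open ≤-Reasoning

inflation-code : ∀ {js} → IsCode V → InflationAlong js V W → IsCode W
inflation-code code done = code
inflation-code {V = V} code (step {j = j} δ _ along) =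
  inflation-code (λ {v} {u} → inflate-code {V = V} code j δ {v} {u}) along

vol-inflation-≤ : ∀ {js} {V W : WordSet n} → IsCode V → InflationAlong js V W → vol V ≤ vol W
vol-inflation-≤ code done = ≤-refl
vol-inflation-≤ {V = V} code (step {j = j} δ le along) =
  ≤-trans (vol-inflate-≤ {V = V} code j δ le)
    (vol-inflation-≤ (λ {v} {u} → inflate-code {V = V} code j δ {v} {u}) along)

-- Clearing along a list of positions

clear : List (Fin n) → Word n → Word n
clear []       v = v
clear (j ∷ js) v = clear js (v [ j ]≔ ⋆)

lookup-clear-∉ : ∀ js {k} (v : Word n) → k ∉ js → lookup (clear js v) k ≡ lookup v k
lookup-clear-∉ []       v k∉ = refl
lookup-clear-∉ (j ∷ js) v k∉ =
  trans (lookup-clear-∉ js (v [ j ]≔ ⋆) (k∉ ∘ there)) (lookup∘update′ (k∉ ∘ here) v ⋆)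

lookup-clear-⋆ : ∀ js {k} {v : Word n} → lookup v k ≡ ⋆ → lookup (clear js v) k ≡ ⋆
lookup-clear-⋆ []       vk = vk
lookup-clear-⋆ (j ∷ js) {k} {v} vk with k Fin.≟ j
... | yes refl = lookup-clear-⋆ js (lookup∘update k v ⋆)
... | no k≢j   = lookup-clear-⋆ js (trans (lookup∘update′ k≢j v ⋆) vk)

lookup-clear-∈ : ∀ {js k} (v : Word n) → k ∈ js → lookup (clear js v) k ≡ ⋆
lookup-clear-∈ {js = j ∷ js} v (here refl) = lookup-clear-⋆ js (lookup∘update j v ⋆)
lookup-clear-∈ {js = j ∷ js} v (there k∈)  = lookup-clear-∈ (v [ j ]≔ ⋆) k∈

clear-id : ∀ js {v : Word n} → (∀ {j} → j ∈ js → lookup v j ≡ ⋆) → clear js v ≡ v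
clear-id []       v⋆ = refl
clear-id (j ∷ js) v⋆ = trans (cong (clear js) (clear-⋆ (v⋆ (here refl)))) (clear-id js (v⋆ ∘ there))

-- The choices decide which words survive, never what a survivor becomes.
∈-inflation⁻ : ∀ {js w} → InflationAlong js V W → w ∈ W → ∃ λ v → v ∈ V × w ≡ clear js v
∈-inflation⁻ done w∈ = _ , w∈ , refl
∈-inflation⁻ {V = V} (step {j = j} δ _ along) w∈ with ∈-inflation⁻ along w∈
... | v′ , v′∈ , refl with ∈-inflate⁻ V j δ v′∈
...   | v , v∈ , _ , refl = v , v∈ , refl

∈-inflation⁺ : ∀ {js v} → InflationAlong js V W → v ∈ V → (∀ {j} → j ∈ js → lookup v j ≡ ⋆) → v ∈ W
∈-inflation⁺ done v∈ v⋆ = v∈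
∈-inflation⁺ {V = V} {v = v} (step {j = j} δ _ along) v∈ v⋆ = ∈-inflation⁺ along
  (subst (_∈ inflate V j δ) (clear-⋆ vj) (∈-inflate⁺ δ v∈ (λ eq → contradiction (trans (sym vj) eq) (λ ()))))
  (v⋆ ∘ there)
  where vj = v⋆ (here refl)

inflation-exists : ∀ js (V : WordSet n) → ∃ (InflationAlong js V)
inflation-exists [] V = V , done
inflation-exists (j ∷ js) V
  with ≤-total (vol (V ^⟨ j , 𝟙 ⟩)) (vol (V ^⟨ j , 𝟘 ⟩))
... | inj₁ le = _ , step false le (proj₂ (inflation-exists js (inflate V j false)))
... | inj₂ le = _ , step true le (proj₂ (inflation-exists js (inflate V j true)))

-- If no inflation gains volume, both choices are allowed at every step, and a
-- word survives when each choice follows its letter.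
inflation-through : ∀ js {V : WordSet n} → IsCode V →
  (∀ {W} → InflationAlong js V W → vol W ≤ vol V) →
  ∀ {v} → v ∈ V → ∃ λ W → InflationAlong js V W × clear js v ∈ W
inflation-through [] code tight v∈ = _ , done , v∈
inflation-through {n} (j ∷ js) {V} code tight {v} v∈ = through (letter-choice (lookup v j))
  where
  letter-choice : ∀ c → ∃ λ η → c ≢ just (not η)
  -- A star survives either choice; `false` is an arbitrary default.
  letter-choice ⋆ = false , λ ()
  letter-choice (just η) = η , just≢just-not η
  inflated : ∀ η → IsCode (inflate V j η)
  inflated η {v} {u} = inflate-code {V = V} code j η {v} {u}
  tie : ∀ η → vol (V ^⟨ j , just (not η) ⟩) ≤ vol (V ^⟨ j , just η ⟩)
  -- If the opposite choice were strictly heavier, taking it would gain volume that later steps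
  -- never lose, against `tight`.
  tie η = ≮⇒≥ λ lt →
    let lt′ = subst (λ ε → vol (V ^⟨ j , just ε ⟩) < vol (V ^⟨ j , just (not η) ⟩)) (sym (not-involutive η)) lt
        W , along = inflation-exists js (inflate V j (not η))
    in <⇒≱ (<-≤-trans (vol-inflate-< {V = V} code j (not η) lt′) (vol-inflation-≤ (λ {v} {u} → inflated (not η) {v} {u}) along))
           (tight (step (not η) (<⇒≤ lt′) along))
  through : (∃ λ η → lookup v j ≢ just (not η)) → ∃ λ W → InflationAlong (j ∷ js) V W × clear js (v [ j ]≔ ⋆) ∈ W
  through (η , vj≢) with inflation-through js {inflate V j η} (λ {v} {u} → inflated η {v} {u})
      -- The inflated code has at least the volume of `V`, so the bound carries over to it.
      (λ along → ≤-trans (tight (step η (tie η) along)) (vol-inflate-≤ {V = V} code j η (tie η)))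
      (∈-inflate⁺ η v∈ vj≢)
  ... | W , along , w∈ = W , step η (tie η) along , w∈

-- Neighborly codes in standard form

mass-half : ∀ ε (r : Word n) v → lookup v zero ≡ just ε → mass (just ε ∷ r) v ≡ mass r (Vec.tail v)
mass-half false r (_ ∷ v) refl = *-identityˡ _
mass-half true  r (_ ∷ v) refl = *-identityˡ _

size-half : ∀ ε (v : Word (suc n)) → lookup v zero ≡ just ε → mass (just ε ∷ ⋆⋯⋆) v ≡ size v
size-half ε v@(_ ∷ u) refl = trans (mass-half ε ⋆⋯⋆ v refl) (mass-⋆⋯⋆ u)

-- Fixing a free coordinate halves a subcube; doubling the left side avoids division.
mass-at-⋆ : ∀ k η (v : Word n) → lookup v k ≡ ⋆ →
  mass (⋆⋯⋆ [ k ]≔ just η) v + mass (⋆⋯⋆ [ k ]≔ just η) v ≡ mass ⋆⋯⋆ v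
mass-at-⋆ zero    η (⋆ ∷ v) refl =
  trans (cong₂ _+_ (*-identityˡ m) (*-identityˡ m)) (sym (2*m≡m+m m))
  where m = mass ⋆⋯⋆ v
mass-at-⋆ (suc k) η (c ∷ v) vk =
  trans (sym (*-distribˡ-+ (common ⋆ c) m m)) (cong (common ⋆ c *_) (mass-at-⋆ k η v vk))
  where m = mass (⋆⋯⋆ [ k ]≔ just η) v

quarter-⋆ : ∀ ε k η (v : Word (suc n)) → lookup v zero ≡ just ε → lookup v (suc k) ≡ ⋆ →
  mass (just ε ∷ ⋆⋯⋆ [ k ]≔ just η) v + mass (just ε ∷ ⋆⋯⋆ [ k ]≔ just η) v ≡ size v
quarter-⋆ ε k η v@(_ ∷ u) refl vk = trans
  (cong₂ _+_ (mass-half ε r v refl) (mass-half ε r v refl))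
  (trans (mass-at-⋆ k η u vk) (mass-⋆⋯⋆ u))
  where r = ⋆⋯⋆ [ k ]≔ just η

unique-position : ∀ (v u : Word n) → Neighborly v u →
  ∀ {i j} → DichotomousAt v u i → DichotomousAt v u j → i ≡ j
unique-position v u (_ , _ , unique) di dj = trans (sym (unique di)) (unique dj)

-- Words from opposite halves already use up their only dichotomy at position 1, while a digit of
-- `u` at `k` would oppose `v` or `v′` there.
C¹-opposite-⋆ : ∀ {V : WordSet (suc n)} → IsNeighborlyCode V → ∀ ε {k} → C¹ V ε k →
  ∀ {u} → u ∈ V ^⟨ zero , just (not ε) ⟩ → lookup u k ≡ ⋆
C¹-opposite-⋆ {V = V} nb ε {k} (k≢0 , v , v′ , v∈ , v′∈ , η , vk , v′k) {u} u∈ with letter-cases (lookup u k) η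
... | inj₂ (inj₂ uk) = uk
... | inj₂ (inj₁ uk) = contradiction (only-zero v v∈ (η , vk , uk)) k≢0
  where
  only-zero : ∀ v → v ∈ V ^⟨ zero , just ε ⟩ → DichotomousAt v u k → k ≡ zero
  only-zero v v∈ dk = unique-position v u
    (nb (^-⊆ V zero _ v∈) (^-⊆ V zero _ u∈) (dichotomous⇒≢ (k , dk)))
    dk (ε , ^-letter V zero v∈ , ^-letter V zero u∈)
... | inj₁ uk = contradiction
  (unique-position v′ u (nb (^-⊆ V zero _ v′∈) (^-⊆ V zero _ u∈) (dichotomous⇒≢ (k , dk)))
    dk (ε , ^-letter V zero v′∈ , ^-letter V zero u∈)) k≢0
  where
  dk : DichotomousAt v′ u k
  dk = not η , v′k , trans uk (cong just (sym (not-involutive η)))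

lookup-ext : ∀ {v u : Word n} → (∀ i → lookup v i ≡ lookup u i) → v ≡ u
lookup-ext {v = v} {u} eq = trans (sym (tabulate∘lookup v)) (trans (tabulate-cong eq) (tabulate∘lookup u))

nonempty : ∀ (V : WordSet n) → card V > 0 → ∃ (_∈ V)
nonempty (v ∷ _) _ = v , here refl

-- A code of degree `suc d` that lacks `M` words

module _
  {n d M : ℕ} {V : WordSet (suc n)}
  (V-d : IsNeighborlyDCode (suc d) V) (V-std : IsStandardForm V)
  (card-V : card V + M ≡ 2 ^ suc d) (X>9M : card (V ^⟨ zero , 𝟘 ⟩) > 9 * M)
  where

  open IsStandardForm V-std using (maximal; D-0⋆)

  private
    code : IsCode V
    code = proj₁ (proj₁ V-d)

    neighborly : IsNeighborlyCode V
    neighborly = proj₂ V-d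

    X Y Z : WordSet (suc n)
    X = V ^⟨ zero , 𝟘 ⟩
    Y = V ^⟨ zero , 𝟙 ⟩
    Z = V ^⟨ zero , ⋆ ⟩

    -- The common size of the words of `V`: `suc d` digits in `suc n` positions leave `n ∸ d` stars.
    -- Volumes are compared as multiples of `e`, which is then cancelled.
    e : ℕ
    e = 2 ^ (n ∸ d)

    size≡e : ∀ {v} → v ∈ V → size v ≡ e
    size≡e v∈ = cong (λ p → 2 ^ (suc n ∸ p)) (proj₂ (proj₁ V-d) v∈)

    -- Some word exists and has `suc d` digits; this prevents truncation in `n ∸ d`.
    d≤n : d ≤ n
    d≤n with nonempty X (≤-trans (s≤s z≤n) X>9M)
    ... | v , v∈ = s≤s⁻¹ (subst (_≤ suc n) (proj₂ (proj₁ V-d) (^-⊆ V zero 𝟘 v∈)) (∣p∣≤n (prop v)))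

    2^n≡ : 2 ^ n ≡ 2 ^ d * e
    2^n≡ = trans (cong (2 ^_) (sym (m+[n∸m]≡n d≤n))) (^-distribˡ-+-* 2 d (n ∸ d))

    cancel-e : ∀ {a b} → a * e ≤ b * e → a ≤ b
    cancel-e {a} {b} = *-cancelʳ-≤ a b e ⦃ m^n≢0 2 (n ∸ d) ⦄

    vol-slice : ∀ a → vol (V ^⟨ zero , a ⟩) ≡ card (V ^⟨ zero , a ⟩) * e
    vol-slice a = ∑-const {V = V ^⟨ zero , a ⟩} (size≡e ∘ ^-⊆ V zero a)

    cube : 2 ^ suc n ≡ M * e + vol V
    cube = begin
      2 ^ suc n               ≡⟨ cong (2 *_) 2^n≡ ⟩
      2 * (2 ^ d * e)         ≡⟨ *-assoc 2 (2 ^ d) e ⟨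
      2 ^ suc d * e           ≡⟨ cong (_* e) card-V ⟨
      (card V + M) * e        ≡⟨ cong (_* e) (+-comm (card V) M) ⟩
      (M + card V) * e        ≡⟨ *-distribʳ-+ e M (card V) ⟩
      M * e + card V * e      ≡⟨ cong (M * e +_) (∑-const {V = V} size≡e) ⟨
      M * e + vol V           ∎
      where open ≡-Reasoning

    -- A code with at least the volume of `V` misses at most `M * e` of the cube. It is applied to
    -- `V` and to its inflations.
    balanceᴹ : ∀ {U : WordSet (suc n)} → IsCode U → vol V ≤ vol U → ∀ ε r →
      ∑ (mass (just ε ∷ r)) (U ^⟨ zero , just ε ⟩) ≤
      ∑ (mass (just (not ε) ∷ r)) (U ^⟨ zero , just (not ε) ⟩) + M * e
    balanceᴹ {U} U-code V≤U ε r = +-cancelʳ-≤ (vol V) _ _ (begin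
      x + vol V              ≤⟨ +-monoʳ-≤ x V≤U ⟩
      x + vol U              ≤⟨ balance U-code ε r ⟩
      y + 2 ^ suc n          ≡⟨ cong (y +_) cube ⟩
      y + (M * e + vol V)    ≡⟨ +-assoc y (M * e) (vol V) ⟨
      y + M * e + vol V      ∎)
      where
      open ≤-Reasoning
      x = ∑ (mass (just ε ∷ r)) (U ^⟨ zero , just ε ⟩)
      y = ∑ (mass (just (not ε) ∷ r)) (U ^⟨ zero , just (not ε) ⟩)

    half-mass : ∀ ε → ∑ (mass (just ε ∷ ⋆⋯⋆)) (V ^⟨ zero , just ε ⟩) ≡ card (V ^⟨ zero , just ε ⟩) * e
    half-mass ε = ∑-const {V = V ^⟨ zero , just ε ⟩}
      (λ {v} v∈ → trans (size-half ε v (^-letter V zero v∈)) (size≡e (^-⊆ V zero _ v∈)))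

    X≤Y+M : card X ≤ card Y + M
    X≤Y+M = cancel-e (begin
      card X * e                             ≡⟨ half-mass false ⟨
      ∑ (mass (𝟘 ∷ ⋆⋯⋆)) X                   ≤⟨ balanceᴹ {V} code ≤-refl false ⋆⋯⋆ ⟩
      ∑ (mass (𝟙 ∷ ⋆⋯⋆)) Y + M * e           ≡⟨ cong (_+ M * e) (half-mass true) ⟩
      card Y * e + M * e                     ≡⟨ *-distribʳ-+ e (card Y) M ⟨
      (card Y + M) * e                       ∎)
      where open ≤-Reasoning

    card-split : ∀ (F : WordSet (suc n)) {k} → (∀ {v} → v ∈ F → lookup v k ≡ 𝟘 ⊎ lookup v k ≡ ⋆) →
      card F ≤ card (F ^⟨ k , 𝟘 ⟩) + card (F ^⟨ k , ⋆ ⟩)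
    card-split F {k} 0⋆ = begin
      card F                                     ≡⟨ card≡∑ F ⟩
      ∑ (const 1) F                              ≤⟨ ∑-⊆ (const 1) cover ⟩
      ∑ (const 1) (F ^⟨ k , 𝟘 ⟩ ++ F ^⟨ k , ⋆ ⟩) ≡⟨ ∑-++ (const 1) (^-disjoint F F k (λ ())) ⟩
      ∑ (const 1) (F ^⟨ k , 𝟘 ⟩) + ∑ (const 1) (F ^⟨ k , ⋆ ⟩)
        ≡⟨ cong₂ _+_ (card≡∑ (F ^⟨ k , 𝟘 ⟩)) (card≡∑ (F ^⟨ k , ⋆ ⟩)) ⟨
      card (F ^⟨ k , 𝟘 ⟩) + card (F ^⟨ k , ⋆ ⟩)  ∎
      where
      open ≤-Reasoning
      cover : F ⊆ F ^⟨ k , 𝟘 ⟩ ++ F ^⟨ k , ⋆ ⟩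
      cover v∈ with 0⋆ v∈
      ... | inj₁ vk = ∈-++⁺ˡ (∈-^ v∈ vk)
      ... | inj₂ vk = ∈-++⁺ʳ (F ^⟨ k , 𝟘 ⟩) (∈-^ v∈ vk)

    -- A word with a star at the position has exactly half its points in the region with 1 there,
    -- whence the factor 2.
    card-⋆-bound : ∀ ε k → card (V ^⟨ zero , just ε ⟩ ^⟨ suc k , ⋆ ⟩) * e ≤
      2 * ∑ (mass (just ε ∷ ⋆⋯⋆ [ k ]≔ 𝟙)) (V ^⟨ zero , just ε ⟩)
    card-⋆-bound ε k = begin
      card F⋆ * e          ≡⟨ ∑-const {V = F⋆} (λ {v} v∈ → trans
                                (quarter-⋆ ε k true v (^-letter V zero (F⋆⊆F v∈)) (^-letter F (suc k) v∈))
                                (size≡e (^-⊆ V zero _ (F⋆⊆F v∈)))) ⟨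
      ∑ (λ v → f v + f v) F⋆  ≡⟨ sum-+ f f (deduplicate _≟ᵂ_ F⋆) ⟩
      ∑ f F⋆ + ∑ f F⋆      ≡⟨ 2*m≡m+m (∑ f F⋆) ⟨
      2 * ∑ f F⋆           ≤⟨ *-monoʳ-≤ 2 (∑-⊆ f F⋆⊆F) ⟩
      2 * ∑ f F            ∎
      where
      open ≤-Reasoning
      F = V ^⟨ zero , just ε ⟩
      F⋆ = F ^⟨ suc k , ⋆ ⟩
      F⋆⊆F = ^-⊆ F (suc k) ⋆
      f = mass (just ε ∷ ⋆⋯⋆ [ k ]≔ 𝟙)

    -- Otherwise nearly all words of X and Y would have the letter 0 at k, so
    -- that V^{k,0} would be larger than the maximum |X|.
    crowded : ∀ k → D V (suc k) → ¬ (∑ (mass (𝟙 ∷ ⋆⋯⋆ [ k ]≔ 𝟙)) Y ≤ M * e)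
    crowded k Dk Y≤ = <⇒≱ X>9M (begin
      card X        ≤⟨ X≤Y+M ⟩
      card Y + M    ≤⟨ +-monoˡ-≤ M Y≤6M ⟩
      6 * M + M     ≤⟨ m≤m+n (6 * M + M) (2 * M) ⟩
      6 * M + M + 2 * M ≡⟨ nine M ⟩
      9 * M         ∎)
      where
      open ≤-Reasoning
      nine : ∀ m → 6 * m + m + 2 * m ≡ 9 * m
      nine = solve-∀
      assoc₂ : ∀ m e → 2 * (m * e) ≡ 2 * m * e
      assoc₂ = solve-∀
      assoc₄ : ∀ m e → 2 * (m * e + m * e) ≡ 4 * m * e
      assoc₄ = solve-∀
      Y⋆≤2M : card (Y ^⟨ suc k , ⋆ ⟩) ≤ 2 * M
      Y⋆≤2M = cancel-e (≤-trans (card-⋆-bound true k)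
        (≤-trans (*-monoʳ-≤ 2 Y≤) (≤-reflexive (assoc₂ M e))))
      -- Balance for `V` carries the bound from `Y` to `X` at the cost of another `M * e`.
      X⋆≤4M : card (X ^⟨ suc k , ⋆ ⟩) ≤ 4 * M
      X⋆≤4M = cancel-e (≤-trans (card-⋆-bound false k)
        (≤-trans (*-monoʳ-≤ 2 (≤-trans (balanceᴹ {V} code ≤-refl false (⋆⋯⋆ [ k ]≔ 𝟙)) (+-monoˡ-≤ (M * e) Y≤)))
          (≤-reflexive (assoc₄ M e))))
      X₀ = X ^⟨ suc k , 𝟘 ⟩
      Y₀ = Y ^⟨ suc k , 𝟘 ⟩
      X₀Y₀⊆ : X₀ ++ Y₀ ⊆ V ^⟨ suc k , 𝟘 ⟩
      X₀Y₀⊆ v∈ with ∈-++⁻ X₀ v∈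
      ... | inj₁ v∈X = ∈-^ (^-⊆ V zero 𝟘 (^-⊆ X (suc k) 𝟘 v∈X)) (^-letter X (suc k) v∈X)
      ... | inj₂ v∈Y = ∈-^ (^-⊆ V zero 𝟙 (^-⊆ Y (suc k) 𝟘 v∈Y)) (^-letter Y (suc k) v∈Y)
      X₀Y₀≤X : card X₀ + card Y₀ ≤ card X
      X₀Y₀≤X = begin
        card X₀ + card Y₀                     ≡⟨ cong₂ _+_ (card≡∑ X₀) (card≡∑ Y₀) ⟩
        ∑ (const 1) X₀ + ∑ (const 1) Y₀       ≡⟨ ∑-++ (const 1) (λ (v∈X , v∈Y) → ^-disjoint V V zero (λ ())
                                                  (^-⊆ X (suc k) 𝟘 v∈X , ^-⊆ Y (suc k) 𝟘 v∈Y)) ⟨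
        ∑ (const 1) (X₀ ++ Y₀)                ≤⟨ ∑-⊆ (const 1) X₀Y₀⊆ ⟩
        ∑ (const 1) (V ^⟨ suc k , 𝟘 ⟩)        ≡⟨ card≡∑ (V ^⟨ suc k , 𝟘 ⟩) ⟨
        card (V ^⟨ suc k , 𝟘 ⟩)               ≤⟨ maximal (suc k) false ⟩
        card X                                ∎
      regroup : ∀ x₀ x⋆ y₀ y⋆ → (x₀ + x⋆) + (y₀ + y⋆) ≡ (x₀ + y₀) + (x⋆ + y⋆)
      regroup = solve-∀
      six : ∀ m → 4 * m + 2 * m ≡ 6 * m
      six = solve-∀
      -- At most 4M + 2M words of `X` and `Y` have a star at the position; the others have 0 there
      -- and number at most `card X` by maximality.
      Y≤6M : card Y ≤ 6 * M
      Y≤6M = +-cancelˡ-≤ (card X) _ _ (begin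
        card X + card Y
          ≤⟨ +-mono-≤ (card-split X (λ v∈ → D-0⋆ Dk (∈-++⁺ˡ v∈))) (card-split Y (λ v∈ → D-0⋆ Dk (∈-++⁺ʳ X v∈))) ⟩
        (card X₀ + card (X ^⟨ suc k , ⋆ ⟩)) + (card Y₀ + card (Y ^⟨ suc k , ⋆ ⟩))
          ≡⟨ regroup (card X₀) _ (card Y₀) _ ⟩
        (card X₀ + card Y₀) + (card (X ^⟨ suc k , ⋆ ⟩) + card (Y ^⟨ suc k , ⋆ ⟩))
          ≤⟨ +-mono-≤ X₀Y₀≤X (+-mono-≤ X⋆≤4M Y⋆≤2M) ⟩
        card X + (4 * M + 2 * M)
          ≡⟨ cong (card X +_) (six M) ⟩
        card X + 6 * M ∎)

  -- The inflations on the positions of `C¹ V false`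

  module _ {s : Fin (suc n)} (C¹₀ : C¹ V false ≐ ⦅ zero , s ⟧) where

    module _ {js : List (Fin (suc n))} (js-J : IsOrderingOf ⦅ zero , s ⟧ js) where

      private
        ∈js⇒C¹ : ∀ {k} → k ∈ js → C¹ V false k
        ∈js⇒C¹ k∈ = proj₂ C¹₀ (Equivalence.to (proj₂ js-J _) k∈)

        C¹⇒∈js : ∀ {k} → C¹ V false k → k ∈ js
        C¹⇒∈js c = Equivalence.from (proj₂ js-J _) (proj₁ C¹₀ c)

        zero∉js : zero ∉ js
        zero∉js 0∈ = proj₁ (∈js⇒C¹ 0∈) refl

        clear-zero : ∀ v → lookup (clear js v) zero ≡ lookup v zero
        clear-zero v = lookup-clear-∉ js v zero∉js

        Y-⋆ : ∀ {u} → u ∈ Y → ∀ {j} → j ∈ js → lookup u j ≡ ⋆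
        Y-⋆ u∈ j∈ = C¹-opposite-⋆ {V = V} neighborly false (∈js⇒C¹ j∈) u∈

        just⇒∉js : ∀ v {k b} → lookup (clear js v) k ≡ just b → k ∉ js
        just⇒∉js v wk k∈ = contradiction (trans (sym (lookup-clear-∈ v k∈)) wk) (λ ())

        just⇒original : ∀ v {k b} → lookup (clear js v) k ≡ just b → lookup v k ≡ just b
        just⇒original v wk = trans (sym (lookup-clear-∉ js v (just⇒∉js v wk))) wk

      module _ {W : WordSet (suc n)} (along : InflationAlong js V W) where

        private
          W-code : IsCode W
          W-code {w} {w′} = inflation-code {V = V} code along {w} {w′}

          V≤W : vol V ≤ vol W
          V≤W = vol-inflation-≤ {V = V} code along

          Y⊆W : Y ⊆ W
          Y⊆W u∈ = ∈-inflation⁺ along (^-⊆ V zero 𝟙 u∈) (Y-⋆ u∈)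

          origin : ∀ {w ε} → w ∈ W ^⟨ zero , just ε ⟩ → ∃ λ v → v ∈ V ^⟨ zero , just ε ⟩ × w ≡ clear js v
          origin w∈ with ∈-inflation⁻ along (^-⊆ W zero _ w∈)
          ... | v , v∈ , refl = v , ∈-^ v∈ (just⇒original v (^-letter W zero w∈)) , refl

          -- A dichotomy of two survivors stems from two words of `X`, so its position lies in
          -- `C¹ V false` and has been cleared.
          W₀-unique : ∀ {w w′} → w ∈ W ^⟨ zero , 𝟘 ⟩ → w′ ∈ W ^⟨ zero , 𝟘 ⟩ → w ≡ w′
          W₀-unique {w} {w′} w∈ w′∈ with w ≟ᵂ w′
          ... | yes w≡w′ = w≡w′
          ... | no w≢w′ with origin w∈ | origin w′∈ | W-code (^-⊆ W zero 𝟘 w∈) (^-⊆ W zero 𝟘 w′∈) w≢w′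
          ...   | v , v∈ , refl | v′ , v′∈ , refl | i , ε , wi , w′i =
            contradiction (C¹⇒∈js (i≢0 , v , v′ , v∈ , v′∈ , ε , just⇒original v wi , just⇒original v′ w′i))
                          (just⇒∉js v wi)
            where
            i≢0 : i ≢ zero
            i≢0 refl = just≢just-not ε (trans (sym wi)
              (trans (^-letter W zero w∈) (trans (sym (^-letter W zero w′∈)) w′i)))

          -- `Y` survives in `W`, so balance for `W` limits it wherever the words starting with 0
          -- leave the matching region empty.
          Y-light : ∀ r → (∀ {w} → w ∈ W ^⟨ zero , 𝟘 ⟩ → mass (𝟘 ∷ r) w ≡ 0) → ∑ (mass (𝟙 ∷ r)) Y ≤ M * e
          Y-light r light = begin
            ∑ (mass (𝟙 ∷ r)) Y                   ≤⟨ ∑-⊆ _ (λ u∈ → ∈-^ (Y⊆W u∈) (^-letter V zero u∈)) ⟩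
            ∑ (mass (𝟙 ∷ r)) (W ^⟨ zero , 𝟙 ⟩)    ≤⟨ balanceᴹ {W} W-code V≤W true r ⟩
            ∑ (mass (𝟘 ∷ r)) (W ^⟨ zero , 𝟘 ⟩) + M * e
              ≡⟨ cong (_+ M * e) (trans (∑-const {V = W ^⟨ zero , 𝟘 ⟩} light) (*-zeroʳ (card (W ^⟨ zero , 𝟘 ⟩)))) ⟩
            M * e                                ∎
            where open ≤-Reasoning

          -- Otherwise the whole half is empty, and `Y-light` gives at most `M` words in `Y`, hence
          -- at most 2M in `X`.
          W₀-nonempty : ∃ (_∈ W ^⟨ zero , 𝟘 ⟩)
          W₀-nonempty with W ^⟨ zero , 𝟘 ⟩ in eq
          ... | w ∷ _ = w , here refl
          ... | []    = contradiction X>9M (≤⇒≯ (begin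
            card X      ≤⟨ X≤Y+M ⟩
            card Y + M  ≤⟨ +-monoˡ-≤ M (cancel-e (≤-trans (≤-reflexive (sym (half-mass true)))
                             (Y-light ⋆⋯⋆ (λ w∈ → contradiction (subst (_ ∈_) eq w∈) (λ ()))))) ⟩
            M + M       ≤⟨ m≤m+n (M + M) (7 * M) ⟩
            M + M + 7 * M ≡⟨ nine M ⟩
            9 * M       ∎))
            where
            open ≤-Reasoning
            nine : ∀ m → m + m + 7 * m ≡ 9 * m
            nine = solve-∀

          -- A surviving digit lies outside `C¹ V false`, and outside `C¹ V true` since `v` belongs
          -- to `X`; so the position is in `D V` and the digit is 0. The only word of `W` starting
          -- with 0 then misses the region with 1 there, making `Y` light against `crowded`.
          W₀-tail-⋆ : ∀ {w} → w ∈ W ^⟨ zero , 𝟘 ⟩ → ∀ k → lookup w (suc k) ≡ ⋆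
          W₀-tail-⋆ {w} w∈ k with lookup w (suc k) in wk | origin w∈
          ... | ⋆      | _ = refl
          ... | just b | v , v∈ , refl =
            contradiction (Y-light (⋆⋯⋆ [ k ]≔ 𝟙) λ {w′} w′∈ →
                mass-dichotomous (𝟘 ∷ ⋆⋯⋆ [ k ]≔ 𝟙) w′
                  (suc k , true , lookup∘update k ⋆⋯⋆ 𝟙 , trans (cong (λ z → lookup z (suc k)) (W₀-unique w′∈ w∈)) wk≡𝟘))
              (crowded k Dk)
            where
            vk : lookup v (suc k) ≡ just b
            vk = just⇒original v wk
            Dk : D V (suc k)
            Dk = (λ ()) , (λ c → just⇒∉js v wk (C¹⇒∈js c)) ,
              (λ c → contradiction (trans (sym vk) (C¹-opposite-⋆ {V = V} neighborly true c v∈)) (λ ()))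
            wk≡𝟘 : lookup (clear js v) (suc k) ≡ 𝟘
            wk≡𝟘 with D-0⋆ Dk (∈-++⁺ˡ v∈)
            ... | inj₁ vk≡𝟘 = trans wk (trans (sym vk) vk≡𝟘)
            ... | inj₂ vk≡⋆ = contradiction (trans (sym vk) vk≡⋆) (λ ())

          W₀≡0⋆⋯⋆ : ∀ {w} → w ∈ W ^⟨ zero , 𝟘 ⟩ → w ≡ 0⋆⋯⋆
          W₀≡0⋆⋯⋆ w∈ = lookup-ext λ where
            zero    → ^-letter W zero w∈
            (suc k) → trans (W₀-tail-⋆ w∈ k) (sym (lookup-replicate k ⋆))

          0⋆⋯⋆∈W : 0⋆⋯⋆ ∈ W
          0⋆⋯⋆∈W with W₀-nonempty
          ... | w , w∈ = subst (_∈ W) (W₀≡0⋆⋯⋆ w∈) (^-⊆ W zero 𝟘 w∈)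

          -- The only digit of `0⋆⋯⋆` is the first, so every other word of the code `W` must oppose
          -- it there.
          ⋆∉W : ∀ {w} → w ∈ W → lookup w zero ≢ ⋆
          ⋆∉W {w} w∈ w₀ with W-code w∈ 0⋆⋯⋆∈W (λ eq → contradiction (trans (sym w₀) (cong (λ z → lookup z zero) eq)) (λ ()))
          ... | zero  , _ , w₀≡ , _ = contradiction (trans (sym w₀) w₀≡) (λ ())
          ... | suc i , _ , _ , ui  = contradiction (trans (sym (lookup-replicate i ⋆)) ui) (λ ())

        inflation-set : W ∼[ set ] ([ 0⋆⋯⋆ ] ++ Y)
        inflation-set = mk⇔ to from
          where
          to : W ⊆ [ 0⋆⋯⋆ ] ++ Y
          to {w} w∈ with letter-cases (lookup w zero) false
          ... | inj₁ w₀        = here (W₀≡0⋆⋯⋆ (∈-^ w∈ w₀))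
          ... | inj₂ (inj₂ w₀) = contradiction w₀ (⋆∉W w∈)
          ... | inj₂ (inj₁ w₀) with origin (∈-^ w∈ w₀)
          ...   | v , v∈ , refl = there (subst (_∈ Y) (sym (clear-id js (Y-⋆ v∈))) v∈)
          from : [ 0⋆⋯⋆ ] ++ Y ⊆ W
          from (here refl) = 0⋆⋯⋆∈W
          from (there u∈)  = Y⊆W u∈

        -- The value is the same for every inflation, so if one gains no volume then none does.
        vol-inflation : vol W ≡ 2 ^ n + card Y * e
        vol-inflation = begin
          vol W
            ≡⟨ ∑-set size (Equivalence.to inflation-set) (Equivalence.from inflation-set) ⟩
          ∑ size ([ 0⋆⋯⋆ ] ++ Y)
            ≡⟨ ∑-++ {V = [ 0⋆⋯⋆ ]} size (λ { (here refl , u∈) → contradiction (^-letter V zero u∈) (λ ()) }) ⟩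
          size (0⋆⋯⋆ {n}) + 0 + vol Y
            ≡⟨ cong₂ _+_ (trans (+-identityʳ _) (size-⋆⋯⋆ n)) (vol-slice 𝟙) ⟩
          2 ^ n + card Y * e ∎
          where open ≡-Reasoning

      -- Without a gain, `inflation-through` yields an inflation containing the cleared `z`, which
      -- still starts with `⋆`; `inflation-set` rules this out.
      vol-inflation-< : Z ≢ [] → ∀ {W} → InflationAlong js V W → vol V < vol W
      vol-inflation-< Z≢[] {W} along with Z in eq
      ... | [] = contradiction refl Z≢[]
      ... | z ∷ _ = ≰⇒> λ W≤V →
        let z∈ : z ∈ Z
            z∈ = subst (z ∈_) (sym eq) (here refl)
            W′ , along′ , w∈ = inflation-through js {V} code
              (λ along″ → ≤-trans (≤-reflexive (trans (vol-inflation along″) (sym (vol-inflation along)))) W≤V)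
              (^-⊆ V zero ⋆ z∈)
        in first-letter (Equivalence.to (inflation-set along′) w∈) (trans (clear-zero z) (^-letter V zero z∈))
        where
        first-letter : ∀ {w} → w ∈ [ 0⋆⋯⋆ ] ++ Y → lookup w zero ≢ ⋆
        first-letter (here refl) ()
        first-letter (there u∈) w₀ = contradiction (trans (sym w₀) (^-letter V zero u∈)) (λ ())

    -- Cardinality bounds

    private
      J? : ∀ k → Dec (⦅ zero , s ⟧ k)
      J? k = (zero {n} Fin.<? k) ×-dec (k Fin.≤? s)

      J-list : List (Fin (suc n))
      J-list = filter J? (allFin (suc n))

      J-ordering : IsOrderingOf ⦅ zero , s ⟧ J-list
      J-ordering = Unique.filter⁺ J? (Unique.allFin⁺ (suc n)) , λ k →
        mk⇔ (λ k∈ → proj₂ (∈-filter⁻ J? {xs = allFin (suc n)} k∈)) (∈-filter⁺ J? (∈-allFin k))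

    module _ (Z≢[] : Z ≢ []) where

      private
        -- Compares `V` with one inflation, whose volume is `(2 ^ d + card Y) * e`.
        V<2^d+Y : card V < 2 ^ d + card Y
        V<2^d+Y = *-cancelʳ-< e _ _ (begin-strict
          card V * e             ≡⟨ ∑-const {V = V} size≡e ⟨
          vol V                  <⟨ vol-inflation-< J-ordering Z≢[] along ⟩
          _                      ≡⟨ vol-inflation J-ordering along ⟩
          2 ^ n + card Y * e     ≡⟨ cong (_+ card Y * e) 2^n≡ ⟩
          2 ^ d * e + card Y * e ≡⟨ *-distribʳ-+ e (2 ^ d) (card Y) ⟨
          (2 ^ d + card Y) * e   ∎)
          where
          open ≤-Reasoning
          along = proj₂ (inflation-exists J-list V)

      Y+M> : card Y + M > 2 ^ d
      Y+M> = +-cancelˡ-< (2 ^ d) _ _ (begin-strict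
        2 ^ d + 2 ^ d           ≡⟨ 2*m≡m+m (2 ^ d) ⟨
        2 ^ suc d               ≡⟨ card-V ⟨
        card V + M              <⟨ +-monoˡ-< M V<2^d+Y ⟩
        2 ^ d + card Y + M      ≡⟨ +-assoc (2 ^ d) (card Y) M ⟩
        2 ^ d + (card Y + M)    ∎)
        where open ≤-Reasoning

      X+M> : card X + M > 2 ^ d
      X+M> = <-≤-trans Y+M> (+-monoˡ-≤ M (maximal zero true))

      -- `X` and `Y` each fall short of `2 ^ d` by less than `M`, while all of `V` falls short of
      -- twice that by exactly `M`.
      Z<M : card Z < M
      Z<M = +-cancelˡ-< (card X + card Y + M) _ _ (begin-strict
        card X + card Y + M + card Z   ≡⟨ swap (card X + card Y) M (card Z) ⟩
        card X + card Y + card Z + M   ≡⟨ cong (_+ M) card-V-split ⟨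
        card V + M                     ≡⟨ card-V ⟩
        2 ^ suc d                      ≡⟨ 2*m≡m+m (2 ^ d) ⟩
        2 ^ d + 2 ^ d                  <⟨ +-mono-< X+M> Y+M> ⟩
        card X + M + (card Y + M)      ≡⟨ regroup (card X) (card Y) M ⟩
        card X + card Y + M + M        ∎)
        where
        open ≤-Reasoning
        swap : ∀ a m z → a + m + z ≡ a + z + m
        swap = solve-∀
        regroup : ∀ x y m → x + m + (y + m) ≡ x + y + m + m
        regroup = solve-∀
        card-V-split : card V ≡ card X + card Y + card Z
        card-V-split = trans (card≡∑ V) (trans (∑-split (const 1) V zero false)
          (sym (cong₂ _+_ (cong₂ _+_ (card≡∑ X) (card≡∑ Y)) (card≡∑ Z))))

corollary1 : (n d M : ℕ) (V : WordSet (suc n)) (s : Fin (suc n)) →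
    d ≥ 1 → IsNeighborlyDCode d V → IsStandardForm V →
    C¹ V false ≐ ⦅ zero , s ⟧ →
    M ≥ 2 → card V + M ≡ 2 ^ d → card (V ^⟨ zero , 𝟘 ⟩) > 9 * M →
    (∀ W → IsInflation V ⦅ zero , s ⟧ W →
    W ∼[ set ] ([ 0⋆⋯⋆ ] ++ V ^⟨ zero , 𝟙 ⟩))
    × (V ^⟨ zero , ⋆ ⟩ ≢ [] →
    (∀ W → IsInflation V ⦅ zero , s ⟧ W → vol W > vol V)
    × card (V ^⟨ zero , ⋆ ⟩) < M
    × card (V ^⟨ zero , 𝟘 ⟩) + M > 2 ^ (d ∸ 1)
    × card (V ^⟨ zero , 𝟙 ⟩) + M > 2 ^ (d ∸ 1))
-- `d ≥ 1` excludes degree 0, and with `suc d` the bound `2 ^ (d ∸ 1)` computes to `2 ^ d`.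
corollary1 n (suc d) M V s _ V-d V-std C¹₀ _ card-V X>9M =
  (λ _ (_ , js-J , along) → inflation-set V-d V-std card-V X>9M C¹₀ js-J along) ,
  λ Z≢[] →
    (λ _ (_ , js-J , along) → vol-inflation-< V-d V-std card-V X>9M C¹₀ js-J Z≢[] along) ,
    Z<M V-d V-std card-V X>9M C¹₀ Z≢[] ,
    X+M> V-d V-std card-V X>9M C¹₀ Z≢[] ,
    Y+M> V-d V-std card-V X>9M C¹₀ Z≢[]
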